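{- For any integer $d>0$, there exists a deterministic algorithm in the adversarial comparator model (against an adaptive adversary) that, on $n$ input items, takes $d$ rounds, makes $n^{1+2/\sqrt{d}}\,d$ comparisons, and returns a $2d$-approximate sorting.
   Context: Adversarial comparator model: we are given $n$ items with unknown real values, accessible only through a comparator which, given two items $x_i,x_j$, returns $\max\{x_i,x_j\}$ if $|x_i-x_j|>1$, and otherwise returns either one as chosen by an adversary; the adversary is adaptive. In the round model, in each round the algorithm submits a set of comparisons, chosen based on answers of previous rounds, and receives all answers. For reals $a,b$ write $a\ge_k b$ if $a\ge b-k$. An ordering $y_1,\dots,y_n$ of the items is a $k$-approximate sorting if $y_j\ge_k y_i$ for all $j>i$.
   Formalization: The unknown item values are taken to be rational numbers instead of real numbers. -}

module Defs where

open import Data.Nat as ℕ using (ℕ; suc; _^_; _≤_; _<_)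
open import Data.Fin using (Fin)
import Data.Fin
open import Data.Fin.Permutation using (Permutation′; _⟨$⟩ʳ_)
open import Data.Bool using (Bool; true; false)
open import Data.Product using (_×_; _,_)
open import Data.List using (List; []; _∷_; _++_; map; length)
open import Data.Nat.ListAction using (sum)
open import Data.Integer using (+_)
open import Data.Rational as ℚ using (ℚ)
open import Relation.Binary.PropositionalEquality using (_≡_)

Query : ℕ → Set
Query n = Fin n × Fin n

-- An answer: true means the comparator returned the first item i as the max,
-- false means it returned j.
Round : ℕ → Set
Round n = List (Query n × Bool)

-- History of all previous rounds, in chronological order.
History : ℕ → Set
History n = List (Round n)

-- A deterministic algorithm in the round model on n items:
-- in each round it submits a list of comparisons depending on the answers of
-- previous rounds; at the end it outputs an ordering y_k = order h ⟨$⟩ʳ k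
-- (position k ↦ item).
record RoundAlgorithm (n : ℕ) : Set where
  field
    queries : History n → List (Query n)
    output  : History n → Permutation′ n

-- An adaptive adversary: given the history so far and the set of comparisons
-- submitted in the current round, it answers each comparison.
Adversary : ℕ → Set
Adversary n = History n → List (Query n) → Query n → Bool

Valid : {n : ℕ} → (Fin n → ℚ) → Adversary n → Set
Valid {n} x adv =
  ∀ (h : History n) (qs : List (Query n)) (i j : Fin n) →
    (x j ℚ.+ 1ℚ ℚ.< x i → adv h qs (i , j) ≡ true) ×
    (x i ℚ.+ 1ℚ ℚ.< x j → adv h qs (i , j) ≡ false)
  where
  1ℚ : ℚ
  1ℚ = ℚ.1ℚ

run : {n : ℕ} → RoundAlgorithm n → Adversary n → ℕ → History n
run A adv 0 = []
run A adv (suc r) =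
  let h  = run A adv r
      qs = RoundAlgorithm.queries A h
  in h ++ (map (λ q → q , adv h qs q) qs ∷ [])

comparisons : {n : ℕ} → History n → ℕ
comparisons h = sum (map length h)

ℕtoℚ : ℕ → ℚ
ℕtoℚ k = (+ k) ℚ./ 1

_≥[_]_ : ℚ → ℚ → ℚ → Set
a ≥[ k ] b = b ℚ.≤ a ℚ.+ k

ApproxSorting : {n : ℕ} → ℚ → (Fin n → ℚ) → Permutation′ n → Set
ApproxSorting {n} k x π =
  ∀ (i j : Fin n) → i Data.Fin.< j → x (π ⟨$⟩ʳ j) ≥[ k ] x (π ⟨$⟩ʳ i)

-- "C ≤ n^{1 + 2/√d} · d", encoded in natural-number arithmetic.
-- For d ≥ 1 this is equivalent to: for all positive integers p, q with
-- p/q < √d (i.e. p² < d q²),  C^p ≤ (d n)^p · n^(2q).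
-- (C/(dn) ≤ n^{2/√d}  ⇔  (C/(dn))^{√d} ≤ n²  ⇔  ∀ p/q < √d, (C/(dn))^{p/q} ≤ n²;
--  the n = 0 case forces C = 0 as it should.)
WithinBound : ℕ → ℕ → ℕ → Set
WithinBound d n C =
  ∀ (p q : ℕ) → 1 ≤ p → 1 ≤ q → p ℕ.* p < d ℕ.* (q ℕ.* q) →
    C ^ p ≤ (d ℕ.* n) ^ p ℕ.* n ^ (2 ℕ.* q)

{-# OPTIONS --safe #-}
module Submission where

{- Let s = ⌈√d⌉ and let m = j + 1 be least with m ^ s ≥ n, so that j ^ s < n.  Run an m-way merge sort with
   s levels.  At level i the lists have length at most m ^ i, and every item x is located in each of the
   other m - 1 = j lists by an m-ary search with j pivots per round, in max 1 i rounds.  An item's score is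
   the sum of its positions in all m lists, and the merged list is the list sorted by score.

   If val x + 2 < val y, then y beats every item that x beats, so y is located no lower than x in every list,
   whatever the adversary does.  If the lists are e-approximately sorted, the position found for x is correct
   up to e + 1, because only the two pivots adjacent to it matter.  Hence val x + (e + 1) < val y forces the
   position of x in its own list to be strictly below that of y, and score x < score y.  So each level adds
   only 1 to the error, and s + 1 ≤ 2 d.

   The rounds total 1 + (1 + ... + (s-1)) ≤ 1 + (s-1)² ≤ d.  The comparisons per item total
   K = j s + j² s (s-1) / 2, which for j ≥ 2 is at most j² s² / 2 ≤ d j².  As p / q < √d ≤ s, it suffices to
   show K ^ s ≤ d ^ s n ². -}

open import Defs
open import Data.Bool using (Bool; true; false; if_then_else_)
open import Data.Empty using (⊥-elim)
open import Data.Fin using (Fin; zero; suc; toℕ; cast)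
open import Data.Fin.Permutation using (Permutation′; _⟨$⟩ʳ_; _∘ₚ_; cast-id)
import Data.Fin.Properties as Fin
import Data.Integer as ℤ
import Data.Integer.Properties as ℤ
open import Data.List using (List; []; _∷_; _++_; _∷ʳ_; map; length; take; drop; lookup; concat; tabulate; allFin; initLast; _∷ʳ′_)
open import Data.List.Membership.Propositional using (_∈_)
open import Data.List.Membership.Propositional.Properties using (∈-lookup)
open import Data.List.Properties using (length-++; length-map; length-take; length-drop; length-tabulate; lookup-tabulate; take++drop≡id; ++-identityʳ; ++-assoc; concat-map; map-tabulate; tabulate-lookup; tabulate-cong)
open import Data.List.Relation.Binary.Permutation.Homogeneous using (onIndices)
open import Data.List.Relation.Binary.Permutation.Propositional using (_↭_; ↭-refl; ↭-trans; ↭-reflexive; ↭-sym; ↭⇒↭ₛ)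
open import Data.List.Relation.Binary.Permutation.Propositional.Properties using (↭-length; All-resp-↭; map⁺; ++⁺)
import Data.List.Relation.Binary.Permutation.Setoid.Properties as PermS
open import Data.List.Relation.Unary.All as All using (All; []; _∷_)
import Data.List.Relation.Unary.All.Properties as All
open import Data.List.Relation.Unary.AllPairs using (AllPairs; []; _∷_)
import Data.List.Relation.Unary.AllPairs.Properties as AllPairs
open import Data.List.Relation.Unary.Any using (here; there)
open import Data.List.Relation.Unary.Sorted.TotalOrder.Properties using (Sorted⇒AllPairs)
import Data.List.Sort
open import Data.Nat using (ℕ; zero; suc; pred; _+_; _*_; _∸_; _^_; _⊔_; _≤_; _<_; z≤n; s≤s; >-nonZero; _≤?_)
open import Data.Nat.Coprimality using (1-coprimeTo) renaming (sym to coprime-sym)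
open import Data.Nat.ListAction using (sum)
open import Data.Nat.Properties
open import Data.Nat.Tactic.RingSolver using (solve-∀)
open import Data.Product using (Σ; ∃-syntax; _×_; _,_; proj₁; proj₂)
open import Data.Product.Properties using (≡-dec)
open import Data.Rational as ℚ using (ℚ; mkℚ; 0ℚ; 1ℚ)
import Data.Rational.Properties as ℚ
open import Data.Sum using (_⊎_; inj₁; inj₂)
open import Data.Unit using (⊤; tt)
open import Function using (_∘_; id)
open import Relation.Binary using (DecTotalOrder; tri<; tri≈; tri>)
import Relation.Binary.Construct.On as On
open import Relation.Binary.PropositionalEquality
open import Relation.Nullary using (yes; no; ¬_; does; contradiction)

-- Protocols as decision trees with a fixed number of rounds.

private variable
  n r r′ k B C : ℕ
  X Y : Set

-- The continuation takes answers to all queries, not only to those asked, so that protocols run in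
-- parallel can share one answer function per round.
data Protocol (n : ℕ) (X : Set) : ℕ → Set where
  return : X → Protocol n X zero
  ask    : List (Query n) → ((Query n → Bool) → Protocol n X r) → Protocol n X (suc r)

value : Protocol n X zero → X
value (return x) = x

firstQueries : Protocol n X (suc r) → List (Query n)
firstQueries (ask qs k) = qs

continue : Protocol n X (suc r) → (Query n → Bool) → Protocol n X r
continue (ask qs k) = k

weaken : r ≤ r′ → Protocol n X r → Protocol n X r′
weaken {r′ = zero}  z≤n     P          = P
weaken {r′ = suc _} z≤n     P          = ask [] λ _ → weaken z≤n P
weaken              (s≤s p) (ask qs k) = ask qs (weaken p ∘ k)

infixl 1 _>>=_
_>>=_ : Protocol n X r → (X → Protocol n Y r′) → Protocol n Y (r + r′)
return x >>= g = g x
ask qs k >>= g = ask qs λ f → k f >>= g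

map-protocol : (X → Y) → Protocol n X r → Protocol n Y r
map-protocol g (return x) = return (g x)
map-protocol g (ask qs k) = ask qs (map-protocol g ∘ k)

parallel : {F : Fin k → Set} → ((i : Fin k) → Protocol n (F i) r) → Protocol n ((i : Fin k) → F i) r
parallel {r = zero}  P = return (value ∘ P)
parallel {r = suc _} P = ask (concat (tabulate (firstQueries ∘ P))) λ f → parallel λ i → continue (P i) f

-- Outcomes under an adaptive adversary.

module Semantics {n} (Ok : Query n → Bool → Set) where

  Sound : List (Query n) → (Query n → Bool) → Set
  Sound qs f = All (λ q → Ok q (f q)) qs

  -- Answers are chosen anew at each node, subject only to `Ok` on the queries asked. A property of
  -- every outcome thus holds against every adaptive adversary whose answers satisfy `Ok`.
  Outcome : Protocol n X r → X → Set
  Outcome (return x) y = x ≡ y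
  Outcome (ask qs k) y = ∃[ f ] Sound qs f × Outcome (k f) y

  outcome-weaken : (p : r ≤ r′) (P : Protocol n X r) {y : X} → Outcome (weaken p P) y → Outcome P y
  outcome-weaken {r′ = zero}  z≤n     P          o           = o
  outcome-weaken {r′ = suc _} z≤n     P          (_ , _ , o) = outcome-weaken z≤n P o
  outcome-weaken              (s≤s p) (ask qs k) (f , s , o) = f , s , outcome-weaken p (k f) o

  outcome->>= : (P : Protocol n X r) {g : X → Protocol n Y r′} {y : Y} → Outcome (P >>= g) y →
                ∃[ x ] Outcome P x × Outcome (g x) y
  outcome->>= (return x) o           = x , refl , o
  outcome->>= (ask qs k) (f , s , o) with outcome->>= (k f) o
  ... | x , o₁ , o₂ = x , (f , s , o₁) , o₂

  outcome-map : (g : X → Y) (P : Protocol n X r) {y : Y} → Outcome (map-protocol g P) y →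
                ∃[ x ] Outcome P x × g x ≡ y
  outcome-map g (return x) eq          = x , refl , eq
  outcome-map g (ask qs k) (f , s , o) with outcome-map g (k f) o
  ... | x , o′ , eq = x , (f , s , o′) , eq

  outcome-value : (P : Protocol n X zero) {y : X} → value P ≡ y → Outcome P y
  outcome-value (return x) eq = eq

  outcome-continue : (P : Protocol n X (suc r)) {f : Query n → Bool} {y : X} → Sound (firstQueries P) f →
                     Outcome (continue P f) y → Outcome P y
  outcome-continue (ask qs k) s o = _ , s , o

  outcome-parallel : {F : Fin k → Set} (P : (i : Fin k) → Protocol n (F i) r) {y : (i : Fin k) → F i} →
                     Outcome (parallel P) y → ∀ i → Outcome (P i) (y i)
  outcome-parallel {r = zero}  P refl        i = outcome-value (P i) refl
  outcome-parallel {r = suc _} P (f , s , o) i =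
    outcome-continue (P i) (All.tabulate⁻ (All.concat⁻ s) i) (outcome-parallel (λ i → continue (P i) f) o i)

-- Counting comparisons.

Cost : Protocol n X r → ℕ → Set
Cost (return _) B = ⊤
Cost (ask qs k) B = ∃[ C ] length qs + C ≤ B × (∀ f → Cost (k f) C)

∑ : (Fin k → ℕ) → ℕ
∑ g = sum (tabulate g)

∑-mono : {g h : Fin k → ℕ} → (∀ i → g i ≤ h i) → ∑ g ≤ ∑ h
∑-mono {zero}  p = z≤n
∑-mono {suc _} p = +-mono-≤ (p zero) (∑-mono (p ∘ suc))

∑-mono-< : {g h : Fin k → ℕ} → (∀ i → g i ≤ h i) → ∀ i → g i < h i → ∑ g < ∑ h
∑-mono-< p zero    lt = +-mono-<-≤ lt (∑-mono (p ∘ suc))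
∑-mono-< p (suc i) lt = +-mono-≤-< (p zero) (∑-mono-< (p ∘ suc) i lt)

∑-+ : (g h : Fin k → ℕ) → ∑ (λ i → g i + h i) ≡ ∑ g + ∑ h
∑-+ {zero}  g h = refl
∑-+ {suc _} g h = trans (cong (g zero + h zero +_) (∑-+ (g ∘ suc) (h ∘ suc)))
                        (interchange (g zero) (h zero) (∑ (g ∘ suc)) (∑ (h ∘ suc)))
  where open import Algebra.Properties.CommutativeSemigroup +-commutativeSemigroup using (interchange)

∑-*ʳ : (g : Fin k → ℕ) → ∀ c → ∑ (λ i → g i * c) ≡ ∑ g * c
∑-*ʳ {zero}  g c = refl
∑-*ʳ {suc _} g c = trans (cong (g zero * c +_) (∑-*ʳ (g ∘ suc) c)) (sym (*-distribʳ-+ c (g zero) _))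

∑-const : ∀ k c → ∑ {k} (λ _ → c) ≡ k * c
∑-const zero    c = refl
∑-const (suc k) c = cong (c +_) (∑-const k c)

length-concat-tabulate : (xss : Fin k → List X) → length (concat (tabulate xss)) ≡ ∑ (length ∘ xss)
length-concat-tabulate {zero}  xss = refl
length-concat-tabulate {suc _} xss =
  trans (length-++ (xss zero)) (cong (length (xss zero) +_) (length-concat-tabulate (xss ∘ suc)))

cost-mono : (P : Protocol n X r) → B ≤ C → Cost P B → Cost P C
cost-mono (return _) B≤C _           = tt
cost-mono (ask _ _)  B≤C (D , p , c) = D , ≤-trans p B≤C , c

cost-weaken : (p : r ≤ r′) (P : Protocol n X r) → Cost P B → Cost (weaken p P) B
cost-weaken {r′ = zero}          z≤n     P         c           = c
cost-weaken {r′ = suc _} {B = B} z≤n     P         c           = B , ≤-refl , λ _ → cost-weaken z≤n P c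
cost-weaken                      (s≤s p) (ask _ k) (D , q , c) = D , q , λ f → cost-weaken p (k f) (c f)

cost->>= : (P : Protocol n X r) {g : X → Protocol n Y r′} → Cost P B → (∀ x → Cost (g x) C) →
           Cost (P >>= g) (B + C)
cost->>= (return x) {g} c cg = cost-mono (g x) (m≤n+m _ _) (cg x)
cost->>= {C = C} (ask _ k) (D , p , c) cg =
  D + C , ≤-trans (≤-reflexive (sym (+-assoc _ D C))) (+-monoˡ-≤ C p) , λ f → cost->>= (k f) (c f) cg

cost-map : (g : X → Y) (P : Protocol n X r) → Cost P B → Cost (map-protocol g P) B
cost-map g (return x) c           = tt
cost-map g (ask _ k)  (D , p , c) = D , p , λ f → cost-map g (k f) (c f)

cost-continue : (P : Protocol n X (suc r)) → Cost P B →
                ∃[ C ] length (firstQueries P) + C ≤ B × (∀ f → Cost (continue P f) C)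
cost-continue (ask _ _) c = c

cost-parallel : {F : Fin k → Set} (P : (i : Fin k) → Protocol n (F i) r) {b : Fin k → ℕ} →
                (∀ i → Cost (P i) (b i)) → Cost (parallel P) (∑ b)
cost-parallel {r = zero}  P cs = tt
cost-parallel {r = suc _} P {b} cs =
  ∑ later ,
  (begin
    length (concat (tabulate (firstQueries ∘ P))) + ∑ later
      ≡⟨ cong (_+ ∑ later) (length-concat-tabulate (firstQueries ∘ P)) ⟩
    ∑ (length ∘ firstQueries ∘ P) + ∑ later
      ≡⟨ ∑-+ (length ∘ firstQueries ∘ P) later ⟨
    ∑ (λ i → length (firstQueries (P i)) + later i)
      ≤⟨ ∑-mono (λ i → proj₁ (proj₂ (split i))) ⟩
    ∑ b ∎) ,
  λ f → cost-parallel (λ i → continue (P i) f) (λ i → proj₂ (proj₂ (split i)) f)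
  where
  open ≤-Reasoning
  split = λ i → cost-continue (P i) (cs i)
  later = λ i → proj₁ (split i)

-- Protocols as round algorithms.

-- Queries absent from the round get the arbitrary answer true.
answerIn : Round n → Query n → Bool
answerIn []             q = true
answerIn ((q′ , b) ∷ h) q with ≡-dec Fin._≟_ Fin._≟_ q q′
... | yes _ = b
... | no  _ = answerIn h q

-- A query repeated within a round causes no conflict: every recorded copy carries the same answer
-- `g q`.
answerIn-map : (g : Query n → Bool) {qs : List (Query n)} {q : Query n} → q ∈ qs →
               answerIn (map (λ q → q , g q) qs) q ≡ g q
answerIn-map g {q′ ∷ qs} {q} q∈ with ≡-dec Fin._≟_ Fin._≟_ q q′ | q∈
... | yes refl | _         = refl
... | no  q≢q′ | here eq   = ⊥-elim (q≢q′ eq)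
... | no  _    | there q∈′ = answerIn-map g q∈′

nextQueries : Protocol n X r → History n → List (Query n)
nextQueries (return _) _        = []
nextQueries (ask qs _) []       = qs
nextQueries (ask _  k) (rd ∷ h) = nextQueries (k (answerIn rd)) h

-- On a history that is too short, missing answers are taken to be true.
result : Protocol n X r → History n → X
result (return x) _        = x
result (ask _ k)  []       = result (k (λ _ → true)) []
result (ask _ k)  (rd ∷ h) = result (k (answerIn rd)) h

algorithm : Protocol n X r → (X → Permutation′ n) → RoundAlgorithm n
algorithm P out = record { queries = nextQueries P ; output = out ∘ result P }

module Execution {n} (Ok : Query n → Bool → Set) (adv : Adversary n)
                 (adv-ok : ∀ h qs q → Ok q (adv h qs q)) where
  open Semantics Ok

  -- A history as a path in the decision tree, from its root to the node reached. The soundness kept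
  -- in `step` yields an `Outcome`, and the equality of lengths yields the cost bound.
  data _⟨_⟩⇒_ {X : Set} : Protocol n X r → History n → Protocol n X r′ → Set where
    done : {P : Protocol n X r} → P ⟨ [] ⟩⇒ P
    step : ∀ {qs rd h} {k : (Query n → Bool) → Protocol n X r} {P : Protocol n X r′} →
           Sound qs (answerIn rd) → length rd ≡ length qs →
           k (answerIn rd) ⟨ h ⟩⇒ P → ask qs k ⟨ rd ∷ h ⟩⇒ P

  ⇒-snoc : ∀ {P : Protocol n X r} {h qs} {k : (Query n → Bool) → Protocol n X r′} {rd} →
           P ⟨ h ⟩⇒ ask qs k → Sound qs (answerIn rd) → length rd ≡ length qs →
           P ⟨ h ++ rd ∷ [] ⟩⇒ k (answerIn rd)
  ⇒-snoc done           s e = step s e done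
  ⇒-snoc (step s′ e′ t) s e = step s′ e′ (⇒-snoc t s e)

  ⇒-nextQueries : ∀ {P : Protocol n X r} {h qs} {k : (Query n → Bool) → Protocol n X r′} →
                  P ⟨ h ⟩⇒ ask qs k → nextQueries P h ≡ qs
  ⇒-nextQueries done         = refl
  ⇒-nextQueries (step _ _ t) = ⇒-nextQueries t

  ⇒-result : ∀ {P : Protocol n X r} {h x} → P ⟨ h ⟩⇒ return x → result P h ≡ x
  ⇒-result done         = refl
  ⇒-result (step _ _ t) = ⇒-result t

  ⇒-outcome : ∀ {P : Protocol n X r} {h x} → P ⟨ h ⟩⇒ return x → Outcome P x
  ⇒-outcome done         = refl
  ⇒-outcome (step s _ t) = _ , s , ⇒-outcome t

  ⇒-cost : ∀ {P : Protocol n X r} {h} {P′ : Protocol n X r′} → P ⟨ h ⟩⇒ P′ → Cost P B → comparisons h ≤ B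
  ⇒-cost done         c           = z≤n
  ⇒-cost (step _ e t) (D , p , c) =
    ≤-trans (+-mono-≤ (≤-reflexive e) (⇒-cost t (c _))) p

  module _ {d} (P : Protocol n X d) (out : X → Permutation′ n) where

    -- `nextQueries` replays the history through `P`, so the queries submitted are those at the node
    -- reached, and the adversary's answers extend the path by one node.
    ⇒-run : ∀ t r → t + r ≡ d → ∃[ P′ ] _⟨_⟩⇒_ {r′ = r} P (run (algorithm P out) adv t) P′
    ⇒-run zero    r refl = P , done
    ⇒-run (suc t) r eq with ⇒-run t (suc r) (trans (+-suc t r) eq)
    ... | ask qs k , s = _ , ⇒-snoc s sound (trans (length-map (λ q → q , g q) (nextQueries P h)) (cong length asked))
      where
      h = run (algorithm P out) adv t
      asked : nextQueries P h ≡ qs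
      asked = ⇒-nextQueries s
      g = adv h (nextQueries P h)
      sound : Sound qs (answerIn (map (λ q → q , g q) (nextQueries P h)))
      sound = All.tabulate λ {q} q∈ →
        subst (Ok q) (sym (answerIn-map g (subst (q ∈_) (sym asked) q∈))) (adv-ok h _ q)

    run-outcome : Outcome P (result P (run (algorithm P out) adv d))
    run-outcome with ⇒-run d zero (+-identityʳ d)
    ... | return x , s = subst (Outcome P) (sym (⇒-result s)) (⇒-outcome s)

    run-cost : Cost P B → comparisons (run (algorithm P out) adv d) ≤ B
    run-cost = ⇒-cost (proj₂ (⇒-run d zero (+-identityʳ d)))

-- The permutation given by a rearrangement of all items.

module _ {xs : List (Fin n)} (xs↭ : xs ↭ allFin n) where

  length-↭-allFin : length xs ≡ n
  length-↭-allFin = trans (↭-length xs↭) (length-tabulate id)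

  ↭⇒permutation : Permutation′ n
  ↭⇒permutation = cast-id (sym length-↭-allFin) ∘ₚ onIndices (↭⇒↭ₛ xs↭) ∘ₚ cast-id (length-tabulate id)

  -- `onIndices` sends an index of `xs` to an index of `allFin n` holding the same item, and in
  -- `allFin n` item and index agree up to a cast.
  ↭⇒permutation-lookup : ∀ i → ↭⇒permutation ⟨$⟩ʳ i ≡ lookup xs (cast (sym length-↭-allFin) i)
  ↭⇒permutation-lookup i = sym (trans (PermS.onIndices-lookup (setoid (Fin n)) (↭⇒↭ₛ xs↭) j)
                                      (lookup-allFin (onIndices (↭⇒↭ₛ xs↭) ⟨$⟩ʳ j)))
    where
    j = cast (sym length-↭-allFin) i
    lookup-allFin : ∀ j → lookup (allFin n) j ≡ cast (length-tabulate id) j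
    lookup-allFin j = trans (cong (lookup (allFin n)) (sym (Fin.cast-involutive (sym e) e j)))
                            (lookup-tabulate id (cast e j))
      where e = length-tabulate {n = n} id

AllPairs-lookup : ∀ {R : X → X → Set} {xs} → AllPairs R xs → ∀ {i j} → i Data.Fin.< j →
                  R (lookup xs i) (lookup xs j)
AllPairs-lookup (px ∷ _)   {zero}  {suc j} _         = All.lookup px (∈-lookup j)
AllPairs-lookup (_  ∷ pxs) {suc i} {suc j} (s≤s i<j) = AllPairs-lookup pxs i<j

-- Searching an approximately sorted list

infixr 2 _∥_
_∥_ : Protocol n X r → Protocol n Y r → Protocol n (X × Y) r
return x   ∥ return y   = return (x , y)
ask qs₁ k₁ ∥ ask qs₂ k₂ = ask (qs₁ ++ qs₂) λ f → k₁ f ∥ k₂ f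

cost-∥ : (P : Protocol n X r) (Q : Protocol n Y r) → Cost P B → Cost Q C → Cost (P ∥ Q) (B + C)
cost-∥ (return _) (return _) _ _ = tt
cost-∥ {B = B} {C = C} (ask qs₁ k₁) (ask qs₂ k₂) (B′ , p , c) (C′ , q , d) =
  B′ + C′ ,
  (begin
    length (qs₁ ++ qs₂) + (B′ + C′)           ≡⟨ cong (_+ (B′ + C′)) (length-++ qs₁) ⟩
    length qs₁ + length qs₂ + (B′ + C′)       ≡⟨ interchange (length qs₁) _ _ _ ⟩
    (length qs₁ + B′) + (length qs₂ + C′)     ≤⟨ +-mono-≤ p q ⟩
    B + C                                     ∎) ,
  λ f → cost-∥ (k₁ f) (k₂ f) (c f) (d f)
  where
  open ≤-Reasoning
  open import Algebra.Properties.CommutativeSemigroup +-commutativeSemigroup using (interchange)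

module _ {Ok : Query n → Bool → Set} where
  open Semantics Ok
  outcome-∥ : (P : Protocol n X r) (Q : Protocol n Y r) {x : X} {y : Y} → Outcome (P ∥ Q) (x , y) →
              Outcome P x × Outcome Q y
  outcome-∥ (return _)   (return _)   refl        = refl , refl
  outcome-∥ (ask qs₁ k₁) (ask qs₂ k₂) (f , s , o) with outcome-∥ (k₁ f) (k₂ f) o
  ... | o₁ , o₂ = (f , All.++⁻ˡ qs₁ s , o₁) , (f , All.++⁻ʳ qs₁ s , o₂)

-- The pivots stand at positions `c`, `2 c + 1`, and so on, with blocks of `c` items between them.
pivots : ℕ → ℕ → List X → List X
pivots zero    c L = []
pivots (suc j) c L with drop c L
... | []       = []
... | p ∷ rest = p ∷ pivots j c rest

-- The scan stops at the first pivot not beaten, so inconsistent answers at later pivots are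
-- harmless. The number returned counts the items passed, beaten pivots included; the list is the
-- block kept.
narrow : (X → Bool) → ℕ → ℕ → List X → ℕ × List X
narrow beats zero    c L = 0 , L
narrow beats (suc j) c L with drop c L
... | []       = 0 , L
... | p ∷ rest with beats p
...   | false = 0 , take c L
...   | true  with narrow beats j c rest
...     | o , S = suc (length (take c L) + o) , S

length-pivots : ∀ j c (L : List X) → length (pivots j c L) ≤ j
length-pivots zero    c L = z≤n
length-pivots (suc j) c L with drop c L
... | []       = z≤n
... | p ∷ rest = s≤s (length-pivots j c rest)

drop≡[]⇒length≤ : ∀ c (L : List X) → drop c L ≡ [] → length L ≤ c
drop≡[]⇒length≤ zero    L       refl = z≤n
drop≡[]⇒length≤ (suc c) []      eq   = z≤n
drop≡[]⇒length≤ (suc c) (_ ∷ L) eq   = s≤s (drop≡[]⇒length≤ c L eq)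

-- Each beaten pivot removes `suc c` items together with its block. If all `j` pivots are beaten,
-- fewer than `suc c` items remain; otherwise the block kept ends at a pivot or at the end of the
-- list.
length-narrow : ∀ (beats : X → Bool) j c L → length L < suc j * suc c →
                length (proj₂ (narrow beats j c L)) < suc c
length-narrow beats zero    c L lt = subst (length L <_) (+-identityʳ (suc c)) lt
length-narrow beats (suc j) c L lt with drop c L in eq
... | []       = s≤s (drop≡[]⇒length≤ c L eq)
... | p ∷ rest with beats p
...   | false = s≤s (≤-trans (≤-reflexive (length-take c L)) (m⊓n≤m c _))
...   | true  = length-narrow beats j c rest
                  (+-cancelˡ-< (suc c) _ _ (≤-<-trans (≤-reflexive (sym lengths)) lt))
  where
  c≤ : c ≤ length L
  c≤ = <⇒≤ (m∸n≢0⇒n<m λ e → 0≢1+n (trans (sym e) (trans (sym (length-drop c L)) (cong length eq))))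
  lengths : length L ≡ suc c + length rest
  lengths = begin
    length L                ≡⟨ m+[n∸m]≡n c≤ ⟨
    c + (length L ∸ c)      ≡⟨ cong (c +_) (trans (sym (length-drop c L)) (cong length eq)) ⟩
    c + suc (length rest)   ≡⟨ +-suc c _ ⟩
    suc c + length rest     ∎
    where open ≡-Reasoning

-- The first pivot that `b₂` fails to beat is the one for `b₁` or a later one. In the first case the
-- same block is kept; in the second the whole block kept for `b₁` is passed by `b₂`, so no later
-- round can reverse the order.
narrow-mono : ∀ (b₁ b₂ : X → Bool) j c L →
              All (λ p → b₁ p ≡ true → b₂ p ≡ true) (pivots j c L) →
              narrow b₁ j c L ≡ narrow b₂ j c L ⊎
              proj₁ (narrow b₁ j c L) + length (proj₂ (narrow b₁ j c L)) ≤ proj₁ (narrow b₂ j c L)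
narrow-mono b₁ b₂ zero    c L _ = inj₁ refl
narrow-mono b₁ b₂ (suc j) c L h with drop c L
narrow-mono b₁ b₂ (suc j) c L h       | []       = inj₁ refl
narrow-mono b₁ b₂ (suc j) c L (h ∷ hs) | p ∷ rest with b₁ p | b₂ p | h
... | true  | false | h′ with () ← h′ refl
... | false | false | _ = inj₁ refl
... | false | true  | _ = inj₂ (m≤n⇒m≤1+n (m≤m+n _ _))
... | true  | true  | _ with narrow-mono b₁ b₂ j c rest hs
...   | inj₁ eq rewrite eq = inj₁ refl
...   | inj₂ le = inj₂ (s≤s (≤-trans (≤-reflexive (+-assoc (length (take c L)) _ _)) (+-monoʳ-≤ (length (take c L)) le)))

AllPairs-++⁻ : ∀ {R : X → X → Set} xs {ys} → AllPairs R (xs ++ ys) →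
               AllPairs R xs × All (λ x → All (R x) ys) xs × AllPairs R ys
AllPairs-++⁻ []       rs       = [] , [] , rs
AllPairs-++⁻ (x ∷ xs) (r ∷ rs) with AllPairs-++⁻ xs rs
... | rxs , cross , rys = All.++⁻ˡ xs r ∷ rxs , All.++⁻ʳ xs r ∷ cross , rys

search : ℕ → ∀ r → ℕ → List (Fin n) → Fin n → Protocol n ℕ r
search j zero    o L x = return o
search j (suc r) o L x = ask (map (x ,_) (pivots j c L)) λ f →
  let o′ , S = narrow (λ p → f (x , p)) j c L in search j r (o + o′) S x
  -- With `m = suc j`, at most `m ^ suc r - 1` items split into `j` pivots and `m` blocks of at most
  -- `m ^ r - 1` items. When no round is left the block is empty and the offset is the position.
  where c = pred (suc j ^ r)

compare : Fin n → Fin n → Protocol n Bool 1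
compare x y = ask ((x , y) ∷ []) λ f → return (f (x , y))

-- With j pivots per round, i rounds distinguish only (j+1)^i positions, one fewer than a list of
-- length (j+1)^i has; comparing with the last element in parallel gains the missing one.
locate-∷ʳ : ℕ → ∀ i → List (Fin n) → Fin n → Fin n → Protocol n ℕ (1 ⊔ i)
-- Beating the last item overrides the search and places `x` after the whole list. For `i = 0` this
-- comparison still takes a round, hence `1 ⊔ i`.
locate-∷ʳ j i xs z x = map-protocol (λ (b , r) → if b then suc (length xs) else r)
  (weaken (m≤m⊔n 1 i) (compare x z) ∥ weaken (m≤n⊔m 1 i) (search j i 0 xs x))

locate : ℕ → ∀ i → List (Fin n) → Fin n → Protocol n ℕ (1 ⊔ i)
locate j i L x with initLast L
... | []       = weaken z≤n (return 0)
... | xs ∷ʳ′ z = locate-∷ʳ j i xs z x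

cost-search : ∀ j r o (L : List (Fin n)) x → Cost (search j r o L x) (r * j)
cost-search j zero    o L x = tt
cost-search j (suc r) o L x =
  r * j ,
  +-monoˡ-≤ (r * j) (≤-trans (≤-reflexive (length-map (x ,_) (pivots j c L))) (length-pivots j c L)) ,
  λ f → let o′ , S = narrow (λ p → f (x , p)) j c L in cost-search j r (o + o′) S x
  where c = pred (suc j ^ r)

cost-locate : ∀ j i (L : List (Fin n)) x → Cost (locate j i L x) (1 + i * j)
cost-locate {n} j i L x with initLast L
... | []       = cost-weaken {n = n} z≤n (return 0) tt
... | xs ∷ʳ′ z = cost-map _ (weaken (m≤m⊔n 1 i) (compare x z) ∥ weaken (m≤n⊔m 1 i) (search j i 0 xs x))
                   (cost-∥ (weaken (m≤m⊔n 1 i) (compare x z)) (weaken (m≤n⊔m 1 i) (search j i 0 xs x))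
                     (cost-weaken (m≤m⊔n 1 i) (compare x z) (0 , ≤-refl , λ _ → tt))
                     (cost-weaken (m≤n⊔m 1 i) (search j i 0 xs x) (cost-search j i 0 xs x)))

-- Correctness and monotonicity of the search.

module Approximate {n} (val : Fin n → ℚ) where

  infix 4 _≲[_]_
  _≲[_]_ : Fin n → ℚ → Fin n → Set
  x ≲[ e ] y = val x ℚ.≤ val y ℚ.+ e

  ≲-refl : ∀ {x e} → 0ℚ ℚ.≤ e → x ≲[ e ] x
  ≲-refl {x} 0≤e = ℚ.≤-trans (ℚ.≤-reflexive (sym (ℚ.+-identityʳ (val x)))) (ℚ.+-monoʳ-≤ (val x) 0≤e)

  ≲-trans : ∀ {x y z e₁ e₂} → x ≲[ e₁ ] y → y ≲[ e₂ ] z → x ≲[ e₂ ℚ.+ e₁ ] z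
  ≲-trans {z = z} {e₁} {e₂} p q =
    ℚ.≤-trans p (ℚ.≤-trans (ℚ.+-monoˡ-≤ e₁ q) (ℚ.≤-reflexive (ℚ.+-assoc (val z) e₂ e₁)))

  ≲-weaken : ∀ {x y e₁ e₂} → e₁ ℚ.≤ e₂ → x ≲[ e₁ ] y → x ≲[ e₂ ] y
  ≲-weaken {y = y} le p = ℚ.≤-trans p (ℚ.+-monoʳ-≤ (val y) le)

  ≲-resp : ∀ {x y e₁ e₂} → e₁ ≡ e₂ → x ≲[ e₁ ] y → x ≲[ e₂ ] y
  ≲-resp refl p = p

  -- What an answer certifies about the values: the contrapositive of `Valid`.
  Ok : Query n → Bool → Set
  Ok (x , y) true  = y ≲[ 1ℚ ] x
  Ok (x , y) false = x ≲[ 1ℚ ] y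

  open Semantics Ok public

  Sorted : ℚ → List (Fin n) → Set
  Sorted e = AllPairs _≲[ e ]_

  -- The gap of more than 2 pays for two comparisons with a common pivot, each wrong by at most 1.
  _≪_ : Fin n → Fin n → Set
  x ≪ y = ¬ (y ≲[ 1ℚ ℚ.+ 1ℚ ] x)

  -- Whatever the adversary does, y beats everything that x beats.
  ok-mono : ∀ {x y p} (b₁ b₂ : Bool) → x ≪ y → Ok (x , p) b₁ → Ok (y , p) b₂ → b₁ ≡ true → b₂ ≡ true
  ok-mono true true  x≪y o₁ o₂ _ = refl
  ok-mono {x} {y} {p} true false x≪y o₁ o₂ _ = ⊥-elim (x≪y (≲-trans {y} {p} {x} o₂ o₁))

  module _ (e : ℚ) (0≤e : 0ℚ ℚ.≤ e) where

    -- The error `1ℚ + e` is 1 for the comparison with a pivot and `e` for the order between the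
    -- pivot and `z`.
    Below Above : Fin n → Fin n → Set
    Below x z = z ≲[ 1ℚ ℚ.+ e ] x
    Above x z = x ≲[ 1ℚ ℚ.+ e ] z

    1≤1+e : 1ℚ ℚ.≤ 1ℚ ℚ.+ e
    1≤1+e = ℚ.≤-trans (ℚ.≤-reflexive (sym (ℚ.+-identityʳ 1ℚ))) (ℚ.+-monoʳ-≤ 1ℚ 0≤e)

    below-pivot : ∀ {x z} → Ok (x , z) true → Below x z
    below-pivot {x} {z} = ≲-weaken {z} {x} 1≤1+e

    above-pivot : ∀ {x z} → Ok (x , z) false → Above x z
    above-pivot {x} {z} = ≲-weaken {x} {z} 1≤1+e

    before-pivot : ∀ {x p z} → Ok (x , p) true → z ≲[ e ] p → Below x z
    before-pivot {x} {p} {z} o s = ≲-trans {z} {p} {x} s o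

    after-pivot : ∀ {x p z} → Ok (x , p) false → p ≲[ e ] z → Above x z
    after-pivot {x} {p} {z} o s = ≲-resp {x} {z} (ℚ.+-comm e 1ℚ) (≲-trans {x} {p} {z} o s)

    record Locates (x : Fin n) (L : List (Fin n)) (r : ℕ) : Set where
      constructor locates
      field
        {before after} : List (Fin n)
        split  : L ≡ before ++ after
        length-before : length before ≡ r
        below  : All (Below x) before
        above  : All (Above x) after

    record Narrows (x : Fin n) (L : List (Fin n)) (o : ℕ) (S : List (Fin n)) : Set where
      constructor narrows
      field
        {before after} : List (Fin n)
        split : L ≡ before ++ S ++ after
        length-before : length before ≡ o
        below  : All (Below x) before
        above  : All (Above x) after

    locates-≤ : ∀ {x L r} → Locates x L r → r ≤ length L
    locates-≤ (locates {before} refl refl _ _) =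
      ≤-trans (m≤m+n _ _) (≤-reflexive (sym (length-++ before)))

    narrows-trivial : ∀ {x L} → Narrows x L 0 L
    narrows-trivial {L = L} = narrows {before = []} (sym (++-identityʳ L)) refl [] []

    -- Each passed block is judged through the beaten pivot that ends it, and everything after the
    -- first unbeaten pivot through that pivot. Every item is thus one comparison and one use of
    -- sortedness away from `x`.
    narrow-narrows : ∀ {x} (f : Query n → Bool) j c L → Sorted e L → Sound (map (x ,_) (pivots j c L)) f →
                     let o , S = narrow (λ p → f (x , p)) j c L in Narrows x L o S
    narrow-narrows f zero    c L _ _ = narrows-trivial
    narrow-narrows {x} f (suc j) c L srt snd with drop c L | take++drop≡id c L
    narrow-narrows {x} f (suc j) c L srt _   | []       | _ = narrows-trivial
    narrow-narrows {x} f (suc j) c L srt (ok ∷ oks) | p ∷ rest | eq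
      with AllPairs-++⁻ (take c L) (subst (Sorted e) (sym eq) srt)
    ... | _ , cross , (after ∷ srt′) with f (x , p)
    ...   | false = narrows {before = []} (sym eq) refl []
                      (above-pivot {x} {p} ok ∷ All.map (λ {z} → after-pivot {x} {p} {z} ok) after)
    ...   | true with narrow (λ p → f (x , p)) j c rest | narrow-narrows f j c rest srt′ oks
    ...     | o , S | narrows {before} split len below above =
      narrows {before = take c L ++ p ∷ before}
        (trans (sym eq) (trans (cong (λ l → take c L ++ p ∷ l) split) (sym (++-assoc (take c L) (p ∷ before) _))))
        (trans (length-++ (take c L)) (trans (cong (λ l → length (take c L) + suc l) len) (+-suc _ o)))
        (All.++⁺ (All.map (λ {z} a → before-pivot {x} {p} {z} ok (All.head a)) cross)
                 (below-pivot {x} {p} ok ∷ below))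
        above

    narrows-sorted : ∀ {x L o S} → Narrows x L o S → Sorted e L → Sorted e S
    narrows-sorted {S = S} (narrows {before} refl _ _ _) srt =
      proj₁ (AllPairs-++⁻ S (proj₂ (proj₂ (AllPairs-++⁻ before srt))))

    -- The bounds of all rounds refer to `x` itself with the same `e`, so errors do not accumulate
    -- over the rounds.
    narrows-locates : ∀ {x L o S r} → Narrows x L o S → Locates x S r → Locates x L (o + r)
    narrows-locates (narrows {b} {a} refl refl be ab) (locates {b′} {a′} refl refl be′ ab′) =
      locates {before = b ++ b′} {after = a′ ++ a}
        (trans (cong (b ++_) (++-assoc b′ a′ a)) (sym (++-assoc b b′ (a′ ++ a))))
        (length-++ b) (All.++⁺ be be′) (All.++⁺ ab′ ab)

    module _ (j : ℕ) where

      private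
        m = suc j

        fits : ∀ r {L : List (Fin n)} → length L < m ^ suc r → length L < m * suc (pred (m ^ r))
        fits r {L} = subst (λ t → length L < m * t) (sym (suc-pred (m ^ r) {{m^n≢0 m r}}))

        fits⁻ : ∀ r {L : List (Fin n)} → length L < suc (pred (m ^ r)) → length L < m ^ r
        fits⁻ r {L} = subst (length L <_) (suc-pred (m ^ r) {{m^n≢0 m r}})

      narrow-invariant : ∀ {x} (f : Query n → Bool) r L → Sorted e L → length L < m ^ suc r →
                         Sound (map (x ,_) (pivots j (pred (m ^ r)) L)) f →
                         let o , S = narrow (λ p → f (x , p)) j (pred (m ^ r)) L in
                         Narrows x L o S × Sorted e S × length S < m ^ r
      narrow-invariant {x} f r L srt lt s =
        N , narrows-sorted N srt ,
        fits⁻ r {proj₂ (narrow (λ p → f (x , p)) j (pred (m ^ r)) L)}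
          (length-narrow (λ p → f (x , p)) j (pred (m ^ r)) L (fits r {L} lt))
        where N = narrow-narrows {x} f j (pred (m ^ r)) L srt s

      search-locates : ∀ {x} r o L {y} → Sorted e L → length L < m ^ r → Outcome (search j r o L x) y →
                       ∃[ s ] y ≡ o + s × Locates x L s
      search-locates zero    o []      _ _        refl = 0 , sym (+-identityʳ o) , locates {before = []} refl refl [] []
      search-locates zero    o (_ ∷ _) _ (s≤s ()) _
      search-locates {x} (suc r) o L srt lt (f , s , out) =
        let N , srt′ , lt′ = narrow-invariant {x} f r L srt lt s
            t , eq , loc   = search-locates r _ _ srt′ lt′ out
        in _ , trans eq (+-assoc o _ t) , narrows-locates N loc

      -- As long as both searches keep the same block, induction applies. Once they separate, the
      -- position of `x` stays within its block, which ends no later than the offset of `y`.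
      search-mono : ∀ {x y} → x ≪ y → ∀ r o L {u v} → Sorted e L → length L < m ^ r →
                    Outcome (search j r o L x) u → Outcome (search j r o L y) v → u ≤ v
      search-mono x≪y zero o L srt lt refl refl = ≤-refl
      search-mono {x} {y} x≪y (suc r) o L {u} {v} srt lt (f , s , out) (f′ , s′ , out′)
        with narrow-invariant {x} f r L srt lt s | narrow-invariant {y} f′ r L srt lt s′
           | narrow-mono (λ p → f (x , p)) (λ p → f′ (y , p)) j (pred (m ^ r)) L
               (All.zipWith (λ {p} (a , b) → ok-mono {x} {y} {p} _ _ x≪y a b) (All.map⁻ s , All.map⁻ s′))
      ... | _ , srt₁ , lt₁ | _ | inj₁ eq =
        search-mono x≪y r _ _ srt₁ lt₁
          out (subst (λ (o′ , S) → Outcome (search j r (o + o′) S y) v) (sym eq) out′)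
      ... | _ , srt₁ , lt₁ | _ , srt₂ , lt₂ | inj₂ le
        with search-locates r _ _ srt₁ lt₁ out | search-locates r _ _ srt₂ lt₂ out′
      ...   | t₁ , refl , loc₁ | t₂ , refl , _ = begin
        o + o₁ + t₁          ≡⟨ +-assoc o o₁ t₁ ⟩
        o + (o₁ + t₁)        ≤⟨ +-monoʳ-≤ o (+-monoʳ-≤ o₁ (locates-≤ loc₁)) ⟩
        o + (o₁ + length S₁) ≤⟨ +-monoʳ-≤ o le ⟩
        o + o₂               ≤⟨ m≤m+n _ _ ⟩
        o + o₂ + t₂          ∎
        where
        open ≤-Reasoning
        o₁ = proj₁ (narrow (λ p → f (x , p)) j (pred (m ^ r)) L)
        S₁ = proj₂ (narrow (λ p → f (x , p)) j (pred (m ^ r)) L)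
        o₂ = proj₁ (narrow (λ p → f′ (y , p)) j (pred (m ^ r)) L)

      Fits : ℕ → List (Fin n) → Set
      Fits i L = Sorted e L × length L ≤ m ^ i

      init-fits : ∀ i xs {z : Fin n} → Fits i (xs ∷ʳ z) →
                  Sorted e xs × length xs < m ^ i
      init-fits i xs {z} (srt , le) =
        proj₁ (AllPairs-++⁻ xs srt) ,
        ≤-trans (≤-reflexive (sym (trans (length-++ xs) (+-comm _ 1)))) le

      outcome-locate-∷ʳ : ∀ {x} i xs {z r} → Outcome (locate-∷ʳ j i xs z x) r →
                          ∃[ b ] ∃[ s ] Ok (x , z) b × Outcome (search j i 0 xs x) s ×
                          (if b then suc (length xs) else s) ≡ r
      outcome-locate-∷ʳ {x} i xs {z} out
        with outcome-map _ (weaken (m≤m⊔n 1 i) (compare x z) ∥ weaken (m≤n⊔m 1 i) (search j i 0 xs x)) out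
      ... | (b , s) , out′ , eq with outcome-∥ (weaken (m≤m⊔n 1 i) (compare x z)) _ out′
      ...   | o₁ , o₂ with outcome-weaken (m≤m⊔n 1 i) (compare x z) o₁
      ...     | f , (ok ∷ []) , refl =
        f (x , z) , s , ok , outcome-weaken (m≤n⊔m 1 i) (search j i 0 xs x) o₂ , eq

      locate-locates : ∀ {x} i L {r} → Fits i L → Outcome (locate j i L x) r → Locates x L r
      locate-locates {x} i L fit out with initLast L
      ... | [] with refl ← outcome-weaken {r′ = 1 ⊔ i} z≤n (return 0) out = locates {before = []} refl refl [] []
      ... | xs ∷ʳ′ z with outcome-locate-∷ʳ {x} i xs out | init-fits i xs fit
      ...   | b , s , ok , out′ , eq | srt , lt with search-locates i 0 xs srt lt out′
      locate-locates {x} i _ fit out | xs ∷ʳ′ z | false , s , ok , out′ , refl | srt , lt | _ , refl , locates {b} {a} refl len be ab =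
        locates {before = b} (++-assoc b a (z ∷ [])) len be (All.++⁺ ab (above-pivot {x} {z} ok ∷ []))
      locate-locates {x} i _ fit out | xs ∷ʳ′ z | true  , s , ok , out′ , refl | srt , lt | _ =
        locates {before = xs ∷ʳ z} (sym (++-identityʳ _)) (trans (length-++ xs) (+-comm _ 1))
          -- Sortedness bounds every earlier item by `z` up to `e`, so beating `z` alone suffices,
          -- whatever the search found.
          (All.++⁺ (All.map (λ {w} before → before-pivot {x} {z} {w} ok (All.head before)) cross)
                   (below-pivot {x} {z} ok ∷ []))
          []
        where cross = proj₁ (proj₂ (AllPairs-++⁻ xs (proj₁ fit)))

      -- The last item acts as one more pivot: `x` cannot beat it while `y` loses to it, and if only
      -- `y` beats it, `y` goes past every position that the search can give `x`.
      locate-mono : ∀ {x y} → x ≪ y → ∀ i L {u v} → Fits i L →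
                    Outcome (locate j i L x) u → Outcome (locate j i L y) v → u ≤ v
      locate-mono {x} {y} x≪y i L fit out out′ with initLast L
      ... | [] with refl ← outcome-weaken {r′ = 1 ⊔ i} z≤n (return 0) out = z≤n
      ... | xs ∷ʳ′ z with outcome-locate-∷ʳ {x} i xs out | outcome-locate-∷ʳ {y} i xs out′ | init-fits i xs fit
      ...   | false , s , _  , o , refl | false , t , _   , o′ , refl | srt , lt = search-mono {x} {y} x≪y i 0 xs srt lt o o′
      ...   | true  , s , _  , o , refl | true  , t , _   , o′ , refl | srt , lt = ≤-refl
      ...   | true  , s , ok , o , refl | false , t , ok′ , o′ , refl | srt , lt with () ← ok-mono {x} {y} {z} true false x≪y ok ok′ refl
      ...   | false , s , _  , o , refl | true  , t , _   , o′ , refl | srt , lt with search-locates i 0 xs srt lt o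
      ...     | _ , refl , loc = m≤n⇒m≤1+n (locates-≤ loc)

      locates-< : ∀ {x L r} → Locates x L r → ∀ k → ¬ Above x (lookup L k) → toℕ k < r
      locates-< (locates {before} {after} refl refl be ab) k ¬above = go before k be ¬above
        where
        go : ∀ before (k : Fin (length (before ++ after))) → All _ before →
             ¬ Above _ (lookup (before ++ after) k) → toℕ k < length before
        go []       k       _        ¬above = ⊥-elim (¬above (All.lookup ab (∈-lookup k)))
        go (b ∷ bs) zero    _        ¬above = s≤s z≤n
        go (b ∷ bs) (suc k) (_ ∷ be) ¬above = s≤s (go bs k be ¬above)

      locates-≥ : ∀ {x L r} → Locates x L r → ∀ k → ¬ Below x (lookup L k) → r ≤ toℕ k
      locates-≥ (locates {before} {after} refl refl be ab) k ¬below = go before k be ¬below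
        where
        go : ∀ before (k : Fin (length (before ++ after))) → All (Below _) before →
             ¬ Below _ (lookup (before ++ after) k) → length before ≤ toℕ k
        go []       k       _        ¬below = z≤n
        go (b ∷ bs) zero    (p ∷ _)  ¬below = ⊥-elim (¬below p)
        go (b ∷ bs) (suc k) (_ ∷ be) ¬below = s≤s (go bs k be ¬below)

-- Multiway merge sort

-- The last chunk takes all that remains, so the chunks concatenate to the input without a bound on
-- its length.
chunks : ∀ k → ℕ → List X → Fin (suc k) → List X
chunks zero    c xs _       = xs
chunks (suc k) c xs zero    = take c xs
chunks (suc k) c xs (suc a) = chunks k c (drop c xs) a

concat-chunks : ∀ k c (xs : List X) → concat (tabulate (chunks k c xs)) ≡ xs
concat-chunks zero    c xs = ++-identityʳ xs
concat-chunks (suc k) c xs = trans (cong (take c xs ++_) (concat-chunks k c (drop c xs))) (take++drop≡id c xs)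

length-chunks : ∀ k c (xs : List X) → length xs ≤ suc k * c → ∀ a → length (chunks k c xs a) ≤ c
length-chunks zero    c xs le a       = ≤-trans le (≤-reflexive (+-identityʳ c))
length-chunks (suc k) c xs le zero    = ≤-trans (≤-reflexive (length-take c xs)) (m⊓n≤m c _)
length-chunks (suc k) c xs le (suc a) = length-chunks k c (drop c xs)
  (≤-trans (≤-reflexive (length-drop c xs)) (≤-trans (∸-monoˡ-≤ c le) (≤-reflexive (m+n∸m≡n c _)))) a

concat-tabulate-↭ : {xss yss : Fin k → List X} → (∀ a → xss a ↭ yss a) →
                    concat (tabulate xss) ↭ concat (tabulate yss)
concat-tabulate-↭ {k = zero}  ps = ↭-refl
concat-tabulate-↭ {k = suc k} ps = ++⁺ (ps zero) (concat-tabulate-↭ (ps ∘ suc))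

byScore : Set → DecTotalOrder _ _ _
byScore X = On.decTotalOrder {B = X × ℕ} ≤-decTotalOrder proj₂

module ScoreSort {X : Set} = Data.List.Sort (byScore X)

module _ (G : Fin k → List X) (R : ∀ a → Fin (length (G a)) → ℕ) where

  row : Fin k → List (X × ℕ)
  row a = tabulate λ q → lookup (G a) q , R a q

  scored : List (X × ℕ)
  scored = concat (tabulate row)

  arrange : List X
  arrange = map proj₁ (ScoreSort.sort scored)

  arrange-↭ : arrange ↭ concat (tabulate G)
  arrange-↭ = ↭-trans (map⁺ proj₁ (ScoreSort.sort-↭ scored)) (↭-reflexive (begin
    map proj₁ scored
      ≡⟨ concat-map (tabulate row) ⟨
    concat (map (map proj₁) (tabulate row))
      ≡⟨ cong concat (map-tabulate row (map proj₁)) ⟩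
    concat (tabulate (map proj₁ ∘ row))
      ≡⟨ cong concat (tabulate-cong λ a →
           trans (map-tabulate (λ q → lookup (G a) q , R a q) proj₁) (tabulate-lookup (G a))) ⟩
    concat (tabulate G) ∎))
    where open ≡-Reasoning

  arrange-AllPairs : {_≼_ : X → X → Set} →
                     (∀ a p b q → R a p ≤ R b q → lookup (G a) p ≼ lookup (G b) q) → AllPairs _≼_ arrange
  arrange-AllPairs {_≼_} h =
    AllPairs.map⁺ (go (All-resp-↭ (↭-sym (ScoreSort.sort-↭ scored)) entries)
                      (Sorted⇒AllPairs (DecTotalOrder.totalOrder (byScore X)) (ScoreSort.sort-↗ scored)))
    where
    -- Sorting forgets the list and index an entry came from; `Entry` recovers them, being preserved
    -- by permutations.
    Entry : X × ℕ → Set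
    Entry e = ∃[ a ] ∃[ q ] e ≡ (lookup (G a) q , R a q)
    entries : All Entry scored
    entries = All.concat⁺ (All.tabulate⁺ λ a → All.tabulate⁺ λ q → a , q , refl)
    compat : ∀ {e e′} → Entry e → Entry e′ → proj₂ e ≤ proj₂ e′ → proj₁ e ≼ proj₁ e′
    compat (a , p , refl) (b , q , refl) = h a p b q
    go : ∀ {es} → All Entry es → AllPairs (λ e e′ → proj₂ e ≤ proj₂ e′) es →
         AllPairs (λ e e′ → proj₁ e ≼ proj₁ e′) es
    go []       []       = []
    go (e ∷ es) (r ∷ rs) = All.zipWith (λ (e′ , le) → compat e e′ le) (es , r) ∷ go es rs

module _ (j i : ℕ) (G : Fin (suc j) → List (Fin n)) where

  place : ∀ a → Fin (length (G a)) → Fin (suc j) → Protocol n ℕ (1 ⊔ i)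
  place a q c with c Fin.≟ a
  -- The position in the item's own list is its index and costs no comparison; empty rounds keep
  -- pace with the searches.
  ... | yes _ = weaken z≤n (return (toℕ q))
  ... | no  _ = locate j i (G c) (lookup (G a) q)

  places : Protocol n (∀ a → Fin (length (G a)) → Fin (suc j) → ℕ) (1 ⊔ i)
  places = parallel λ a → parallel λ q → parallel λ c → place a q c

  -- The permutation proof travels with the list because a `RoundAlgorithm` must output a
  -- permutation on every history, even one that no valid adversary produces.
  merge : Protocol n (∃[ L ] L ↭ concat (tabulate G)) (1 ⊔ i)
  merge = map-protocol (λ R → let S = λ a q → ∑ (R a q) in arrange G S , arrange-↭ G S) places

rounds : ℕ → ℕ
rounds zero    = 0
rounds (suc i) = rounds i + (1 ⊔ i)

mergeSort : ∀ j i (xs : List (Fin n)) → Protocol n (∃[ L ] L ↭ xs) (rounds i)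
mergeSort j zero    xs = return (xs , ↭-refl)
mergeSort j (suc i) xs =
  parallel (λ a → mergeSort j i (chunks j (suc j ^ i) xs a)) >>= λ G →
  map-protocol (λ (L , L↭) → L , ↭-trans L↭ (↭-trans (concat-tabulate-↭ (proj₂ ∘ G))
                                                   (↭-reflexive (concat-chunks j (suc j ^ i) xs))))
               (merge j i (proj₁ ∘ G))

-- Comparisons made by the merge sort.

∑-others : ∀ j (a : Fin (suc j)) B → ∑ (λ c → if does (c Fin.≟ a) then 0 else B) ≤ j * B
∑-others j       zero    B = ≤-reflexive (∑-const j B)
∑-others (suc j) (suc a) B = +-monoʳ-≤ B (∑-others j a B)

module _ (j i : ℕ) (G : Fin (suc j) → List (Fin n)) where

  cost-place : ∀ a q c → Cost (place j i G a q c) (if does (c Fin.≟ a) then 0 else 1 + i * j)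
  cost-place a q c with c Fin.≟ a
  ... | yes _ = cost-weaken {r′ = 1 ⊔ i} {n = n} z≤n (return (toℕ q)) tt
  ... | no  _ = cost-locate j i (G c) (lookup (G a) q)

  cost-merge : Cost (merge j i G) (∑ (length ∘ G) * (j * (1 + i * j)))
  cost-merge = cost-map _ (places j i G) (cost-mono (places j i G) (≤-reflexive total)
    (cost-parallel (λ a → parallel λ q → parallel λ c → place j i G a q c)
      λ a → cost-parallel (λ q → parallel λ c → place j i G a q c)
      λ q → cost-mono (parallel λ c → place j i G a q c) (∑-others j a (1 + i * j))
              (cost-parallel (λ c → place j i G a q c) λ c → cost-place a q c)))
    where
    total : ∑ (λ a → ∑ {length (G a)} λ q → j * (1 + i * j)) ≡ ∑ (length ∘ G) * (j * (1 + i * j))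
    total = trans (cong sum (tabulate-cong λ a → ∑-const (length (G a)) (j * (1 + i * j)))) (∑-*ʳ (length ∘ G) _)

costPerItem : ℕ → ℕ → ℕ
costPerItem j zero    = 0
costPerItem j (suc i) = costPerItem j i + j * (1 + i * j)

cost-mergeSort : ∀ j i (xs : List (Fin n)) → Cost (mergeSort j i xs) (length xs * costPerItem j i)
cost-mergeSort j zero    xs = tt
cost-mergeSort j (suc i) xs =
  cost-mono (mergeSort j (suc i) xs)
    (≤-reflexive (trans (cong (λ t → t * costPerItem j i + t * (j * (1 + i * j))) total)
                        (sym (*-distribˡ-+ (length xs) (costPerItem j i) _))))
    (cost->>= (parallel (λ a → mergeSort j i (ys a)))
      (cost-mono (parallel (λ a → mergeSort j i (ys a))) (≤-reflexive (∑-*ʳ (length ∘ ys) (costPerItem j i)))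
        (cost-parallel (λ a → mergeSort j i (ys a)) λ a → cost-mergeSort j i (ys a)))
      λ G → cost-map _ (merge j i (proj₁ ∘ G))
              (cost-mono (merge j i (proj₁ ∘ G))
                (*-monoˡ-≤ (j * (1 + i * j)) (∑-mono λ a → ≤-reflexive (↭-length (proj₂ (G a)))))
                (cost-merge j i (proj₁ ∘ G))))
  where
  ys = chunks j (suc j ^ i) xs
  total : ∑ (length ∘ ys) ≡ length xs
  total = trans (sym (length-concat-tabulate ys)) (cong length (concat-chunks j (suc j ^ i) xs))

-- Correctness of the merge sort.

err : ℕ → ℚ
-- Starting from 1 instead of 0 makes `err (suc i)` at least 2, so that exceeding it gives the gap
-- required by `≪` already at the first merge.
err zero    = 1ℚ
err (suc i) = 1ℚ ℚ.+ err i

1≤err : ∀ i → 1ℚ ℚ.≤ err i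
1≤err zero    = ℚ.≤-refl
1≤err (suc i) = ℚ.≤-trans (ℚ.≤-trans (ℚ.≤-reflexive (sym (ℚ.+-identityʳ 1ℚ))) (ℚ.+-monoʳ-≤ 1ℚ (ℚ.nonNegative⁻¹ 1ℚ)))
                          (ℚ.+-monoʳ-≤ 1ℚ (1≤err i))

0≤err : ∀ i → 0ℚ ℚ.≤ err i
0≤err i = ℚ.≤-trans (ℚ.nonNegative⁻¹ 1ℚ) (1≤err i)

module Correctness {n} (val : Fin n → ℚ) (j : ℕ) where
  open Approximate val

  module _ (i : ℕ) (G : Fin (suc j) → List (Fin n)) (fits : ∀ a → Fits (err i) (0≤err i) j i (G a))
           (R : ∀ a → Fin (length (G a)) → Fin (suc j) → ℕ)
           (out : ∀ a q c → Outcome (place j i G a q c) (R a q c)) where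

    own : ∀ a q → R a q a ≡ toℕ q
    own a q with a Fin.≟ a | out a q a
    ... | yes _  | o = sym (outcome-weaken {r′ = 1 ⊔ i} z≤n (return (toℕ q)) o)
    ... | no a≢a | _ = ⊥-elim (a≢a refl)

    foreign : ∀ a q c → c ≢ a → Outcome (locate j i (G c) (lookup (G a) q)) (R a q c)
    foreign a q c c≢a with c Fin.≟ a | out a q c
    ... | yes c≡a | _ = ⊥-elim (c≢a c≡a)
    ... | no _    | o = o

    foreign-locates : ∀ a q c → c ≢ a → Locates (err i) (0≤err i) (lookup (G a) q) (G c) (R a q c)
    foreign-locates a q c c≢a = locate-locates (err i) (0≤err i) j i (G c) (fits c) (foreign a q c c≢a)

    module _ a p b q (y≰x : ¬ (lookup (G b) q ≲[ err (suc i) ] lookup (G a) p)) where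

      private
        x = lookup (G a) p
        y = lookup (G b) q

      x≪y : x ≪ y
      x≪y y≲x = y≰x (≲-weaken {y} {x} (ℚ.+-monoʳ-≤ 1ℚ (1≤err i)) y≲x)

      -- The list of `x` makes the scores differ. If `y` comes from another list, `x` is too far
      -- below `y` to lie after the position found for `y`; if from the same list, approximate
      -- sortedness puts `y` after `x`.
      rank-own : R a p a < R b q a
      rank-own with a Fin.≟ b
      ... | no a≢b = subst (_< R b q a) (sym (own a p))
                       (locates-< (err i) (0≤err i) j (foreign-locates b q a a≢b) p y≰x)
      ... | yes refl = subst₂ _<_ (sym (own a p)) (sym (own a q)) p<q
        where
        p<q : toℕ p < toℕ q
        p<q with Fin.<-cmp p q
        ... | tri< lt _ _    = lt
        ... | tri≈ _ refl _  = ⊥-elim (y≰x (≲-refl {y} (0≤err (suc i))))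
        ... | tri> _ _ gt    = ⊥-elim (y≰x (≲-weaken {y} {x} err≤ (AllPairs-lookup (proj₁ (fits a)) gt)))
          where
          err≤ : err i ℚ.≤ err (suc i)
          err≤ = ℚ.≤-trans (ℚ.≤-reflexive (sym (ℚ.+-identityˡ (err i)))) (ℚ.+-monoˡ-≤ (err i) (ℚ.nonNegative⁻¹ 1ℚ))

      -- In the list of `y`, the item `y` is too far above `x` to lie before the position found for
      -- `x`. In a third list both items are searched for, and `locate-mono` compares the results.
      rank-≤ : ∀ c → R a p c ≤ R b q c
      rank-≤ c with c Fin.≟ a | c Fin.≟ b
      ... | yes refl | _        = <⇒≤ rank-own
      ... | no c≢a   | yes refl = subst (R a p c ≤_) (sym (own c q))
                                    (locates-≥ (err i) (0≤err i) j (foreign-locates a p c c≢a) q y≰x)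
      ... | no c≢a   | no c≢b   = locate-mono (err i) (0≤err i) j x≪y i (G c) (fits c)
                                    (foreign a p c c≢a) (foreign b q c c≢b)

      score-< : ∑ (R a p) < ∑ (R b q)
      score-< = ∑-mono-< rank-≤ a rank-own

    arrange-sorted : Sorted (err (suc i)) (arrange G (λ a q → ∑ (R a q)))
    -- By contraposition, with the roles exchanged: an earlier item exceeding a later one by more
    -- than `err (suc i)` would have the larger score.
    arrange-sorted = arrange-AllPairs G (λ a q → ∑ (R a q)) λ a p b q le →
      ℚ.≮⇒≥ λ lt → ≤⇒≯ le (score-< b q a p (λ y≲x → ℚ.<-irrefl refl (ℚ.<-≤-trans lt y≲x)))

  merge-sorted : ∀ i G → (∀ a → Fits (err i) (0≤err i) j i (G a)) → ∀ {L} → Outcome (merge j i G) L →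
                 Sorted (err (suc i)) (proj₁ L)
  merge-sorted i G fits out with outcome-map _ (places j i G) out
  ... | R , out′ , refl = arrange-sorted i G fits R λ a q c →
    outcome-parallel (place j i G a q)
      (outcome-parallel (λ q → parallel (place j i G a q))
        (outcome-parallel (λ a → parallel λ q → parallel (place j i G a q)) out′ a) q) c

  mergeSort-sorted : ∀ i xs {L} → length xs ≤ suc j ^ i → Outcome (mergeSort j i xs) L →
                     Sorted (err i) (proj₁ L)
  mergeSort-sorted zero    []          le        refl = []
  mergeSort-sorted zero    (x ∷ [])    le        refl = [] ∷ []
  mergeSort-sorted zero    (_ ∷ _ ∷ _) (s≤s ())  _
  mergeSort-sorted (suc i) xs le out =
    let G , outs , out′     = outcome->>= (parallel λ a → mergeSort j i (ys a)) out
        (L , _) , out″ , eq = outcome-map _ (merge j i (proj₁ ∘ G)) out′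
        fits = λ a → mergeSort-sorted i (ys a) (short a) (outcome-parallel (λ a → mergeSort j i (ys a)) outs a) ,
                     ≤-trans (≤-reflexive (↭-length (proj₂ (G a)))) (short a)
    in subst (Sorted (err (suc i))) (cong proj₁ eq) (merge-sorted i (proj₁ ∘ G) fits out″)
    where
    ys = chunks j (suc j ^ i) xs
    short : ∀ a → length (ys a) ≤ suc j ^ i
    short = length-chunks j (suc j ^ i) xs le

-- The numerical bounds

-- Supplies integer parts of roots: t = ⌈√d⌉ - 1, and the largest j with j^s < n.
bracket : (f : ℕ → ℕ) → f 0 ≡ 0 → (∀ i → f i < f (suc i)) → ∀ v → ∃[ i ] f i ≤ v × v < f (suc i)
bracket f f0 f< zero    = 0 , ≤-reflexive f0 , ≤-<-trans (≤-reflexive (sym f0)) (f< 0)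
bracket f f0 f< (suc v) with bracket f f0 f< v
... | i , le , lt with suc v <? f (suc i)
...   | yes lt′ = i , m≤n⇒m≤1+n le , lt′
...   | no  ≥   = suc i , ≮⇒≥ ≥ , ≤-<-trans lt (f< (suc i))

-- Level 0 takes one round and level `i ≥ 1` takes `i`. Together with `t * t < d` this leaves the
-- sort within `d` rounds.
rounds-suc : ∀ t → rounds (suc t) ≤ suc (t * t)
rounds-suc zero    = ≤-refl
rounds-suc (suc t) = begin
  rounds (suc t) + suc t       ≤⟨ +-monoˡ-≤ (suc t) (rounds-suc t) ⟩
  suc (t * t) + suc t          ≤⟨ m≤m+n _ t ⟩
  suc (t * t) + suc t + t      ≡⟨ identity t ⟩
  suc (suc t * suc t)          ∎
  where
  open ≤-Reasoning
  identity : ∀ t → suc (t * t) + suc t + t ≡ suc (suc t * suc t)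
  identity = solve-∀

-- The closed form K = j s + j² s (s-1) / 2, with both sides moved so that no subtraction or division occurs.
costPerItem-closed : ∀ j s → 2 * costPerItem j s + j * j * s ≡ 2 * j * s + j * j * (s * s)
costPerItem-closed j zero    = base j
  where
  base : ∀ j → 2 * 0 + j * j * 0 ≡ 2 * j * 0 + j * j * (0 * 0)
  base = solve-∀
costPerItem-closed j (suc s) = begin
  2 * (K + j * (1 + s * j)) + j * j * suc s              ≡⟨ expand K j s ⟩
  (2 * K + j * j * s) + (2 * j + j * j * (2 * s + 1))    ≡⟨ cong (_+ (2 * j + j * j * (2 * s + 1))) (costPerItem-closed j s) ⟩
  (2 * j * s + j * j * (s * s)) + (2 * j + j * j * (2 * s + 1)) ≡⟨ collect j s ⟩
  2 * j * suc s + j * j * (suc s * suc s)                ∎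
  where
  open ≡-Reasoning
  K = costPerItem j s
  expand : ∀ K j s → 2 * (K + j * (1 + s * j)) + j * j * suc s ≡ (2 * K + j * j * s) + (2 * j + j * j * (2 * s + 1))
  expand = solve-∀
  collect : ∀ j s → (2 * j * s + j * j * (s * s)) + (2 * j + j * j * (2 * s + 1)) ≡ 2 * j * suc s + j * j * (suc s * suc s)
  collect = solve-∀

-- The difference `2 (t² + 1) - (t + 1)²` is the square `(t - 1)²`.
suc²≤2* : ∀ {d} t → t * t < d → suc t * suc t ≤ 2 * d
suc²≤2* {d} t lt = ≤-trans (bound t) (*-monoʳ-≤ 2 lt)
  where
  bound : ∀ t → suc t * suc t ≤ 2 * suc (t * t)
  bound zero    = s≤s z≤n
  bound (suc u) = ≤-trans (m≤m+n _ (u * u)) (≤-reflexive (identity u))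
    where
    identity : ∀ u → suc (suc u) * suc (suc u) + u * u ≡ 2 * suc (suc u * suc u)
    identity = solve-∀

-- The hypothesis `2 * j ≤ j * j`, which excludes only `j = 1`, lets the term `j² s` on the left of
-- the closed form absorb the linear term `2 j s`.
costPerItem≤ : ∀ {d j} t → t * t < d → 2 * j ≤ j * j → costPerItem j (suc t) ≤ d * (j * j)
costPerItem≤ {d} {j} t lt 2j≤jj = *-cancelˡ-≤ 2 (+-cancelʳ-≤ (j * j * s) _ _ (begin
  2 * costPerItem j s + j * j * s         ≡⟨ costPerItem-closed j s ⟩
  2 * j * s + j * j * (s * s)             ≤⟨ +-mono-≤ (*-monoˡ-≤ s 2j≤jj) (*-monoʳ-≤ (j * j) (suc²≤2* t lt)) ⟩
  j * j * s + j * j * (2 * d)             ≡⟨ rearrange (j * j) s d ⟩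
  2 * (d * (j * j)) + j * j * s           ∎))
  where
  open ≤-Reasoning
  s = suc t
  rearrange : ∀ a s d → a * s + a * (2 * d) ≡ 2 * (d * a) + a * s
  rearrange = solve-∀

-- For `j = 1` the cost is `s (s + 1) / 2`. With `t = s - 1 = 3 + u`, twice `t² + 1` exceeds
-- `s (s + 1)` by `t (t - 3) = u² + 3 u`.
costPerItem-1≤ : ∀ {d} u → (3 + u) * (3 + u) < d → costPerItem 1 (4 + u) ≤ d
costPerItem-1≤ {d} u lt = *-cancelˡ-≤ 2 (+-cancelʳ-≤ (1 * 1 * (4 + u)) _ _ (begin
  2 * costPerItem 1 (4 + u) + 1 * 1 * (4 + u)           ≡⟨ costPerItem-closed 1 (4 + u) ⟩
  2 * 1 * (4 + u) + 1 * 1 * ((4 + u) * (4 + u))         ≤⟨ m≤m+n _ (u * u + 3 * u) ⟩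
  2 * 1 * (4 + u) + 1 * 1 * ((4 + u) * (4 + u)) + (u * u + 3 * u) ≡⟨ identity u ⟩
  2 * suc ((3 + u) * (3 + u)) + 1 * 1 * (4 + u)         ≤⟨ +-monoˡ-≤ (1 * 1 * (4 + u)) (*-monoʳ-≤ 2 lt) ⟩
  2 * d + 1 * 1 * (4 + u)                               ∎))
  where
  open ≤-Reasoning
  identity : ∀ u → 2 * 1 * (4 + u) + 1 * 1 * ((4 + u) * (4 + u)) + (u * u + 3 * u) ≡ 2 * suc ((3 + u) * (3 + u)) + 1 * 1 * (4 + u)
  identity = solve-∀

^-distrib-* : ∀ a b e → (a * b) ^ e ≡ a ^ e * b ^ e
^-distrib-* a b zero    = refl
^-distrib-* a b (suc e) = trans (cong (a * b *_) (^-distrib-* a b e)) (interchange a b (a ^ e) (b ^ e))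
  where open import Algebra.Properties.CommutativeSemigroup *-commutativeSemigroup using (interchange)

^-monoˡ-≤-* : ∀ {K d n} s → K ≤ d → 0 < n → K ^ s ≤ d ^ s * n ^ 2
^-monoˡ-≤-* {d = d} {n} s K≤d 0<n =
  ≤-trans (^-monoˡ-≤ s K≤d) (m≤m*n (d ^ s) (n ^ 2) {{m^n≢0 n 2 {{>-nonZero 0<n}}}})

-- Raising `K ≤ d j²` to the power `s` produces `(j ^ s)²`, and `j ^ s < n` is used once for each
-- factor.
costPerItem-^-2≤ : ∀ {d n} j t → t * t < d → j ^ suc t < n → 2 * j ≤ j * j →
                   costPerItem j (suc t) ^ suc t ≤ d ^ suc t * n ^ 2
costPerItem-^-2≤ {d} {n} j t lt j^<n 2j≤jj = begin
  costPerItem j s ^ s          ≤⟨ ^-monoˡ-≤ s (costPerItem≤ t lt 2j≤jj) ⟩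
  (d * (j * j)) ^ s            ≡⟨ ^-distrib-* d (j * j) s ⟩
  d ^ s * (j * j) ^ s          ≡⟨ cong (d ^ s *_) (^-distrib-* j j s) ⟩
  d ^ s * (j ^ s * j ^ s)      ≤⟨ *-monoʳ-≤ (d ^ s) (*-mono-≤ (<⇒≤ j^<n) (<⇒≤ j^<n)) ⟩
  d ^ s * (n * n)              ≡⟨ cong (λ m → d ^ s * (n * m)) (*-identityʳ n) ⟨
  d ^ s * n ^ 2                ∎
  where
  open ≤-Reasoning
  s = suc t

-- For j = 1 and s = 2, 3 the cost per item (3, resp. 6) may exceed d, and the factor n² ≥ 4 is needed.
costPerItem-^ : ∀ {d n} j t → t * t < d → j ^ suc t < n → costPerItem j (suc t) ^ suc t ≤ d ^ suc t * n ^ 2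
costPerItem-^ 0             t lt j^<n = costPerItem-^-2≤ 0 t lt j^<n z≤n
costPerItem-^ (suc (suc j)) t lt j^<n = costPerItem-^-2≤ (2 + j) t lt j^<n (*-monoˡ-≤ (2 + j) {2} {2 + j} (s≤s (s≤s z≤n)))
costPerItem-^ 1 0 lt j^<n = ^-monoˡ-≤-* {1} 1 lt (≤-<-trans z≤n j^<n)
-- Here `d ≥ 2` and `n ≥ 2`, so `3² ≤ 2² · 2²` suffices; in the next case `d ≥ 5` and `n ≥ 2`, so
-- `6³ ≤ 5³ · 2²` does.
costPerItem-^ 1 1 lt j^<n = ≤-trans (≤ᵇ⇒≤ 9 16 _) (*-mono-≤ (^-monoˡ-≤ 2 lt) (^-monoˡ-≤ 2 j^<n))
costPerItem-^ 1 2 lt j^<n = ≤-trans (≤ᵇ⇒≤ 216 500 _) (*-mono-≤ (^-monoˡ-≤ 3 lt) (^-monoˡ-≤ 2 j^<n))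
costPerItem-^ 1 (suc (suc (suc u))) lt j^<n = ^-monoˡ-≤-* (4 + u) (costPerItem-1≤ u lt) (≤-<-trans z≤n j^<n)

-- In the case `K > d`, raise the hypothesis to the power `q` and cancel the surplus factor
-- `(K / d) ^ (s q - p)`, which is at least 1.
^-≤-interpolate : ∀ {K d c} s p q → 0 < d → 0 < c → p ≤ s * q → K ^ s ≤ d ^ s * c → K ^ p ≤ d ^ p * c ^ q
^-≤-interpolate {K} {d} {c} s p q 0<d 0<c p≤sq h with K ≤? d
... | yes K≤d = ≤-trans (^-monoˡ-≤ p K≤d) (m≤m*n (d ^ p) (c ^ q) {{m^n≢0 c q {{>-nonZero 0<c}}}})
... | no  K≰d = *-cancelˡ-≤ (d ^ e) {{m^n≢0 d e {{>-nonZero 0<d}}}} (begin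
  d ^ e * K ^ p         ≤⟨ *-monoˡ-≤ (K ^ p) (^-monoˡ-≤ e (≰⇒≥ K≰d)) ⟩
  K ^ e * K ^ p         ≡⟨ ^-distribˡ-+-* K e p ⟨
  K ^ (e + p)           ≡⟨ cong (K ^_) (m∸n+n≡m p≤sq) ⟩
  K ^ (s * q)           ≡⟨ ^-*-assoc K s q ⟨
  (K ^ s) ^ q           ≤⟨ ^-monoˡ-≤ q h ⟩
  (d ^ s * c) ^ q       ≡⟨ ^-distrib-* (d ^ s) c q ⟩
  (d ^ s) ^ q * c ^ q   ≡⟨ cong (_* c ^ q) (trans (^-*-assoc d s q) (cong (d ^_) (sym (m∸n+n≡m p≤sq)))) ⟩
  d ^ (e + p) * c ^ q   ≡⟨ cong (_* c ^ q) (^-distribˡ-+-* d e p) ⟩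
  d ^ e * d ^ p * c ^ q ≡⟨ *-assoc (d ^ e) (d ^ p) (c ^ q) ⟩
  d ^ e * (d ^ p * c ^ q) ∎)
  where
  open ≤-Reasoning
  e = s * q ∸ p

within-bound : ∀ {d n C} j t → t * t < d → d ≤ suc t * suc t → j ^ suc t < n →
               C ≤ n * costPerItem j (suc t) → WithinBound d n C
within-bound {d} {n} {C} j t lt d≤ j^<n C≤ p q 1≤p 1≤q pp<dqq = begin
  C ^ p                        ≤⟨ ^-monoˡ-≤ p C≤ ⟩
  (n * K) ^ p                  ≡⟨ ^-distrib-* n K p ⟩
  n ^ p * K ^ p                ≤⟨ *-monoʳ-≤ (n ^ p) K^p≤ ⟩
  n ^ p * (d ^ p * (n ^ 2) ^ q) ≡⟨ regroup (n ^ p) (d ^ p) _ ⟩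
  d ^ p * n ^ p * (n ^ 2) ^ q  ≡⟨ cong₂ _*_ (sym (^-distrib-* d n p)) (^-*-assoc n 2 q) ⟩
  (d * n) ^ p * n ^ (2 * q)    ∎
  where
  open ≤-Reasoning
  s = suc t
  K = costPerItem j s
  0<n² : 0 < n ^ 2
  0<n² = m^n>0 n {{>-nonZero (≤-<-trans z≤n j^<n)}} 2
  -- Otherwise `d q² ≤ s² q² < p²`, against `p² < d q²`.
  p≤sq : p ≤ s * q
  p≤sq = ≮⇒≥ λ sq<p → <-asym pp<dqq (≤-<-trans (≤-trans (*-monoˡ-≤ (q * q) d≤) (≤-reflexive (square s q)))
                                       (*-mono-< sq<p sq<p))
    where
    square : ∀ s q → s * s * (q * q) ≡ s * q * (s * q)
    square = solve-∀
  K^p≤ : K ^ p ≤ d ^ p * (n ^ 2) ^ q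
  K^p≤ = ^-≤-interpolate s p q (≤-<-trans z≤n lt) 0<n² p≤sq (costPerItem-^ j t lt j^<n)
  regroup : ∀ a b c → a * (b * c) ≡ b * a * c
  regroup = solve-∀

within-bound-0 : ∀ {d C} → C ≤ 0 → WithinBound d 0 C
within-bound-0 z≤n (suc p) q _ _ _ = z≤n

-- The error bound as a rational number.

ℕtoℚ-mkℚ : ∀ k → ℕtoℚ k ≡ mkℚ (ℤ.+ k) 0 (coprime-sym (1-coprimeTo k))
ℕtoℚ-mkℚ k = ℚ.normalize-coprime (coprime-sym (1-coprimeTo k))

ℕtoℚ-suc : ∀ k → ℕtoℚ (suc k) ≡ 1ℚ ℚ.+ ℕtoℚ k
ℕtoℚ-suc k = trans (cong (λ i → ((ℤ.+ 1) ℤ.+ i) ℚ./ 1) (sym (ℤ.*-identityʳ (ℤ.+ k))))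
                   (cong (1ℚ ℚ.+_) (sym (ℕtoℚ-mkℚ k)))

ℕtoℚ-mono : ∀ {k l} → k ≤ l → ℕtoℚ k ℚ.≤ ℕtoℚ l
ℕtoℚ-mono {k} {l} k≤l = subst₂ ℚ._≤_ (sym (ℕtoℚ-mkℚ k)) (sym (ℕtoℚ-mkℚ l))
  (ℚ.*≤* (ℤ.*-monoʳ-≤-nonNeg (ℤ.+ 1) (ℤ.+≤+ k≤l)))

err-ℕtoℚ : ∀ i → err i ≡ ℕtoℚ (suc i)
err-ℕtoℚ zero    = refl
err-ℕtoℚ (suc i) = trans (cong (1ℚ ℚ.+_) (err-ℕtoℚ i)) (sym (ℕtoℚ-suc (suc i)))

-- `err (suc t)` is the number `t + 2`, at most `2 (t² + 1)`.
err≤ : ∀ {d} t → t * t < d → err (suc t) ℚ.≤ ℕtoℚ (2 * d)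
err≤ {d} t lt = subst (ℚ._≤ ℕtoℚ (2 * d)) (sym (err-ℕtoℚ (suc t))) (ℕtoℚ-mono (begin
  2 + t             ≤⟨ +-monoʳ-≤ 2 (≤-trans (t≤tt t) (m≤n*m (t * t) 2)) ⟩
  2 + 2 * (t * t)   ≡⟨ *-suc 2 (t * t) ⟨
  2 * suc (t * t)   ≤⟨ *-monoʳ-≤ 2 lt ⟩
  2 * d             ∎))
  where
  open ≤-Reasoning
  t≤tt : ∀ t → t ≤ t * t
  t≤tt zero    = z≤n
  t≤tt (suc t) = m≤m*n (suc t) (suc t)

-- The sorting algorithm with `d` rounds.

valid⇒ok : ∀ {n} {x : Fin n → ℚ} {adv : Adversary n} → Valid x adv →
           ∀ h qs q → Approximate.Ok x q (adv h qs q)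
valid⇒ok {adv = adv} valid h qs (i , j) with adv h qs (i , j) | valid h qs i j
... | true  | _ , wins = ℚ.≮⇒≥ λ lt → contradiction (wins lt) λ ()
... | false | wins , _ = ℚ.≮⇒≥ λ lt → contradiction (wins lt) λ ()

module SortInRounds (d t : ℕ) (t²<d : t * t < d) (d≤s² : d ≤ suc t * suc t) where

  s = suc t

  arity : ∀ n → ∃[ j ] n ≤ suc j ^ s × (0 < n → j ^ s < n)
  arity zero    = 0 , z≤n , id
  arity (suc n) with bracket (_^ s) refl (λ j → ^-monoˡ-< s (n<1+n j)) n
  -- Bracketing the predecessor turns `j ^ s ≤ n < suc j ^ s` into the two required bounds on
  -- `suc n`.
  ... | j , le , lt = j , lt , λ _ → s≤s le

  protocol : ∀ n → Protocol n (∃[ L ] L ↭ allFin n) d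
  protocol n = weaken (≤-trans (rounds-suc t) t²<d) (mergeSort (proj₁ (arity n)) s (allFin n))

  A : ∀ n → RoundAlgorithm n
  A n = algorithm (protocol n) (↭⇒permutation ∘ proj₂)

  module _ {n} (x : Fin n → ℚ) (adv : Adversary n) (valid : Valid x adv) where
    open Approximate x
    open Execution Ok adv (valid⇒ok {x = x} {adv} valid)

    private
      j = proj₁ (arity n)
      h = run (A n) adv d
      sort = mergeSort j s (allFin n)

    comparisons≤ : comparisons h ≤ n * costPerItem j s
    comparisons≤ = run-cost (protocol n) (↭⇒permutation ∘ proj₂)
      (cost-weaken (≤-trans (rounds-suc t) t²<d) sort
        (subst (λ l → Cost sort (l * costPerItem j s)) (length-tabulate {n = n} id) (cost-mergeSort j s (allFin n))))

    withinBound : WithinBound d n (comparisons h)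
    withinBound = go n refl
      where
      -- The bound `j ^ s < n` is available only for positive `n`, so the empty input is treated
      -- apart.
      go : ∀ m → m ≡ n → WithinBound d n (comparisons h)
      go zero    refl = within-bound-0 {d} comparisons≤
      go (suc m) refl = within-bound j t t²<d d≤s² (proj₂ (proj₂ (arity n)) (s≤s z≤n)) comparisons≤

    approxSorting : ApproxSorting (ℕtoℚ (2 * d)) x (RoundAlgorithm.output (A n) h)
    approxSorting i k i<k = subst₂ (_≲[ ℕtoℚ (2 * d) ]_) (sym (at i)) (sym (at k))
      (≲-weaken {lookup L (index i)} {lookup L (index k)} (err≤ t t²<d)
        (AllPairs-lookup sorted (subst₂ _<_ (sym (Fin.toℕ-cast _ i)) (sym (Fin.toℕ-cast _ k)) i<k)))
      where
      L = proj₁ (result (protocol n) h)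
      L↭ = proj₂ (result (protocol n) h)
      index : Fin n → Fin (length L)
      index = cast (sym (length-↭-allFin L↭))
      at = ↭⇒permutation-lookup L↭
      sorted : Sorted (err s) L
      sorted = Correctness.mergeSort-sorted x j s (allFin n)
        (≤-trans (≤-reflexive (length-tabulate id)) (proj₁ (proj₂ (arity n))))
        (outcome-weaken (≤-trans (rounds-suc t) t²<d) sort (run-outcome (protocol n) (↭⇒permutation ∘ proj₂)))

theorem1p8 : (d : ℕ) → 0 < d →
    Σ ((n : ℕ) → RoundAlgorithm n) λ A →
    (n : ℕ) (x : Fin n → ℚ) (adv : Adversary n) → Valid x adv →
    WithinBound d n (comparisons (run (A n) adv d)) ×
    ApproxSorting (ℕtoℚ (2 * d)) x (RoundAlgorithm.output (A n) (run (A n) adv d))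
-- Bracketing the predecessor of the number of rounds gives `t² < suc d ≤ (t + 1)²`, so `t + 1` is
-- its square root rounded up.
theorem1p8 (suc d) _ with bracket (λ t → t * t) refl (λ t → *-mono-< (n<1+n t) (n<1+n t)) d
... | t , t²≤d , d<s² = A , λ n x adv valid → withinBound x adv valid , approxSorting x adv valid
  where open SortInRounds (suc d) t (s≤s t²≤d) d<s²
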